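{- For every set $A \subseteq \mathbb{N}$, $$\underline{\underline{d}}(A) = d_*(A) \qquad\text{and}\qquad \overline{\overline{d}}(A) = d^*(A).$$
   Context: $\mathbb{N}=\{1,2,3,\dots\}$. For $A\subseteq\mathbb{N}$ let $A(n)=|A\cap[1,n]|$. Let $\mathcal{D}$ be the collection of all $A\subseteq\mathbb{N}$ for which the asymptotic density $d(A)=\lim_{n\to\infty}\frac{A(n)}{n}$ exists. Define $\underline{\underline{d}}(A)=\sup\{d(B);\ B\subseteq A,\ B\in\mathcal{D}\}$ and $\overline{\overline{d}}(A)=\inf\{d(C);\ C\supseteq A,\ C\in\mathcal{D}\}$. Define $d_*(A)=\sup \frac{\sum_{i=1}^{p}d(A_i)-\sum_{j=1}^{q}d(B_j)}{k}$, where the supremum is over all finite collections $A_1,\dots,A_p,B_1,\dots,B_q$ of sets in $\mathcal{D}$ and positive integers $k$ such that $k\chi_A+\sum_{j=1}^q\chi_{B_j}\ge\sum_{i=1}^p\chi_{A_i}$ pointwise on $\mathbb{N}$ ($\chi$ denotes the characteristic function). Define $d^*(A)=\inf \frac{\sum_{i=1}^{p}d(A_i)-\sum_{j=1}^{q}d(B_j)}{k}$, the infimum over all finite collections $A_1,\dots,A_p,B_1,\dots,B_q\in\mathcal{D}$ and positive integers $k$ such that $k\chi_A+\sum_{j=1}^q\chi_{B_j}\le\sum_{i=1}^p\chi_{A_i}$ pointwise. -}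

module Defs where

open import Axiom.ExcludedMiddle using (ExcludedMiddle)
open import Data.Integer as ℤ using (+_)
open import Data.List as List using (List; map; foldr)
open import Data.Nat as ℕ using (ℕ; zero; suc; NonZero)
import Data.Nat.Properties as ℕ
open import Data.Product using (Σ; ∃; _×_; _,_)
open import Data.Rational
  using (ℚ; 0ℚ; 1ℚ; ½; _/_; ∣_∣)
import Data.Rational as ℚ
import Data.Rational.Properties as ℚ
import Data.Rational.Solver as ℚSolver
import Data.Rational.Unnormalised as ℚᵘ
import Data.Rational.Unnormalised.Properties as ℚᵘ
open import Level using (0ℓ; Lift)
open import Relation.Binary.PropositionalEquality
  using (_≡_; refl; sym; trans; cong; subst)
open import Relation.Nullary.Decidable.Core using (does)
open import Data.Bool using (if_then_else_)
open import Relation.Unary using (Pred)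

IsCauchy : (ℕ → ℚ) → Set
IsCauchy x = ∀ ε → 0ℚ ℚ.< ε →
  ∃ λ N → ∀ m n → N ℕ.≤ m → N ℕ.≤ n → ∣ x m ℚ.- x n ∣ ℚ.≤ ε

record ℝ : Set where
  constructor mkℝ
  field
    approx : ℕ → ℚ
    cauchy : IsCauchy approx

open ℝ public

infix 4 _≤ᴿ_

-- Real equality is ≤ᴿ in both directions; a supremum or infimum in ℝ is
-- unique up to it.
_≤ᴿ_ : ℝ → ℝ → Set
x ≤ᴿ y = ∀ ε → 0ℚ ℚ.< ε →
  ∃ λ N → ∀ n → N ℕ.≤ n → approx x n ℚ.≤ approx y n ℚ.+ ε

fromℚ : ℚ → ℝ
fromℚ q = mkℝ (λ _ → q) λ ε 0<ε → 0 , λ _ _ _ _ →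
  ℚ.≤-trans (ℚ.≤-reflexive (cong ∣_∣ (ℚ.+-inverseʳ q))) (ℚ.<⇒≤ 0<ε)

private
  half-pos : ∀ {ε} → 0ℚ ℚ.< ε → 0ℚ ℚ.< ½ ℚ.* ε
  half-pos {ε} 0<ε = subst (ℚ._< ½ ℚ.* ε) (ℚ.*-zeroʳ ½) (ℚ.*-monoʳ-<-pos ½ 0<ε)

  halves : ∀ ε → ½ ℚ.* ε ℚ.+ ½ ℚ.* ε ≡ ε
  halves ε = trans (sym (ℚ.*-distribʳ-+ ε ½ ½)) (ℚ.*-identityˡ ε)

  +-diff : ∀ a b c d → (a ℚ.+ b) ℚ.- (c ℚ.+ d) ≡ (a ℚ.- c) ℚ.+ (b ℚ.- d)
  +-diff = solve 4 (λ a b c d → (a :+ b) :- (c :+ d) := (a :- c) :+ (b :- d)) refl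
    where open ℚSolver.+-*-Solver

  neg-diff : ∀ a b → (ℚ.- a) ℚ.- (ℚ.- b) ≡ ℚ.- (a ℚ.- b)
  neg-diff = solve 2 (λ a b → (:- a) :- (:- b) := :- (a :- b)) refl
    where open ℚSolver.+-*-Solver

  *-diff : ∀ a b c → a ℚ.* c ℚ.- b ℚ.* c ≡ (a ℚ.- b) ℚ.* c
  *-diff = solve 3 (λ a b c → a :* c :- b :* c := (a :- b) :* c) refl
    where open ℚSolver.+-*-Solver

  1/k≤1 : ∀ k .{{_ : NonZero k}} → + 1 / k ℚ.≤ 1ℚ
  1/k≤1 (suc m) = ℚ.toℚᵘ-cancel-≤
    (ℚᵘ.≤-respˡ-≃ (ℚᵘ.≃-sym (ℚ.toℚᵘ-fromℚᵘ (ℚᵘ.mkℚᵘ (+ 1) m)))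
      (ℚᵘ.*≤* (ℤ.+≤+ (ℕ.s≤s ℕ.z≤n))))

  ∣p/k∣≤∣p∣ : ∀ p k .{{_ : NonZero k}} → ∣ p ℚ.* (+ 1 / k) ∣ ℚ.≤ ∣ p ∣
  ∣p/k∣≤∣p∣ p k = begin
    ∣ p ℚ.* (+ 1 / k) ∣      ≡⟨ ℚ.∣p*q∣≡∣p∣*∣q∣ p (+ 1 / k) ⟩
    ∣ p ∣ ℚ.* ∣ + 1 / k ∣    ≡⟨ cong (∣ p ∣ ℚ.*_) (ℚ.0≤p⇒∣p∣≡p (ℚ.nonNegative⁻¹ _ {{ℚ.normalize-nonNeg 1 k}})) ⟩
    ∣ p ∣ ℚ.* (+ 1 / k)      ≤⟨ ℚ.*-monoˡ-≤-nonNeg ∣ p ∣ {{ℚ.∣-∣-nonNeg p}} (1/k≤1 k) ⟩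
    ∣ p ∣ ℚ.* 1ℚ             ≡⟨ ℚ.*-identityʳ ∣ p ∣ ⟩
    ∣ p ∣                    ∎
    where open ℚ.≤-Reasoning

infixl 6 _+ᴿ_ _-ᴿ_
infixl 7 _/ᴿ_

_+ᴿ_ : ℝ → ℝ → ℝ
x +ᴿ y = mkℝ (λ n → approx x n ℚ.+ approx y n) λ ε 0<ε →
  let N₁ , p = cauchy x (½ ℚ.* ε) (half-pos 0<ε)
      N₂ , q = cauchy y (½ ℚ.* ε) (half-pos 0<ε)
  in N₁ ℕ.+ N₂ , λ m n N≤m N≤n →
    let a = approx x ; b = approx y in
    subst (λ r → ∣ r ∣ ℚ.≤ ε) (sym (+-diff (a m) (b m) (a n) (b n)))
      (ℚ.≤-trans (ℚ.∣p+q∣≤∣p∣+∣q∣ (a m ℚ.- a n) (b m ℚ.- b n))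
        (ℚ.≤-trans
          (ℚ.+-mono-≤
            (p m n (ℕ.m+n≤o⇒m≤o N₁ N≤m) (ℕ.m+n≤o⇒m≤o N₁ N≤n))
            (q m n (ℕ.m+n≤o⇒n≤o N₁ N≤m) (ℕ.m+n≤o⇒n≤o N₁ N≤n)))
          (ℚ.≤-reflexive (halves ε))))

-ᴿ_ : ℝ → ℝ
-ᴿ x = mkℝ (λ n → ℚ.- approx x n) λ ε 0<ε →
  let N , p = cauchy x ε 0<ε
  in N , λ m n N≤m N≤n →
    subst (ℚ._≤ ε)
      (sym (trans (cong ∣_∣ (neg-diff (approx x m) (approx x n)))
                  (ℚ.∣-p∣≡∣p∣ (approx x m ℚ.- approx x n))))
      (p m n N≤m N≤n)

_-ᴿ_ : ℝ → ℝ → ℝ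
x -ᴿ y = x +ᴿ (-ᴿ y)

_/ᴿ_ : ℝ → (k : ℕ) → .{{_ : NonZero k}} → ℝ
x /ᴿ k = mkℝ (λ n → approx x n ℚ.* (+ 1 / k)) λ ε 0<ε →
  let N , p = cauchy x ε 0<ε
  in N , λ m n N≤m N≤n →
    subst (λ r → ∣ r ∣ ℚ.≤ ε) (sym (*-diff (approx x m) (approx x n) (+ 1 / k)))
      (ℚ.≤-trans (∣p/k∣≤∣p∣ (approx x m ℚ.- approx x n) k) (p m n N≤m N≤n))

sumᴿ : List ℝ → ℝ
sumᴿ = foldr _+ᴿ_ (fromℚ 0ℚ)

infix 4 _⟶_

-- The two inequalities together say |aₙ - x| ≤ ε.
_⟶_ : (ℕ → ℚ) → ℝ → Set
a ⟶ x = ∀ ε → 0ℚ ℚ.< ε → ∃ λ N → ∀ n → N ℕ.≤ n →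
  fromℚ (a n) ≤ᴿ x +ᴿ fromℚ ε × x ≤ᴿ fromℚ (a n) +ᴿ fromℚ ε

IsSup : ∀ {i} {I : Set i} → (I → ℝ) → ℝ → Set i
IsSup f x = (∀ i → f i ≤ᴿ x) × (∀ y → (∀ i → f i ≤ᴿ y) → x ≤ᴿ y)

IsInf : ∀ {i} {I : Set i} → (I → ℝ) → ℝ → Set i
IsInf f x = (∀ i → x ≤ᴿ f i) × (∀ y → (∀ i → y ≤ᴿ f i) → y ≤ᴿ x)

-- A set of positive integers is given by a predicate on ℕ of which only
-- the values at n ≥ 1 are ever used.
Subset : Set₁
Subset = Pred ℕ 0ℓ

infix 4 _⊆⁺_

_⊆⁺_ : Subset → Subset → Set
A ⊆⁺ B = ∀ n → 1 ℕ.≤ n → A n → B n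

-- The ambient logic of the theory is classical: excluded middle is what
-- makes the {0,1}-valued characteristic function of an arbitrary set, and
-- hence the counting function, available.
module Density (em : ExcludedMiddle (Level.suc 0ℓ)) where

  χ : Subset → ℕ → ℕ
  χ A n = if does (em {Lift (Level.suc 0ℓ) (A n)}) then 1 else 0

  -- count A n = |A ∩ [1,n]|
  count : Subset → ℕ → ℕ
  count A zero    = 0
  count A (suc n) = count A n ℕ.+ χ A (suc n)

  -- The sequence A(n)/n starts at n = 1, so it is indexed with a shift.
  HasDensity : Subset → ℝ → Set
  HasDensity A x = (λ n → + count A (suc n) / suc n) ⟶ x

  record 𝒟 : Set₁ where
    constructor mk𝒟
    field
      set        : Subset
      d          : ℝ
      hasDensity : HasDensity set d

  open 𝒟 public

  IsInnerDensity : Subset → ℝ → Set₁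
  IsInnerDensity A = IsSup {I = Σ 𝒟 λ B → set B ⊆⁺ A} λ (B , _) → d B

  IsOuterDensity : Subset → ℝ → Set₁
  IsOuterDensity A = IsInf {I = Σ 𝒟 λ C → A ⊆⁺ set C} λ (C , _) → d C

  -- Collections may be empty and may contain repetitions.
  record Collections : Set₁ where
    constructor mkCollections
    field
      As Bs       : List 𝒟
      k           : ℕ
      .{{k≢0}}    : NonZero k

    quotient : ℝ
    quotient = (sumᴿ (map d As) -ᴿ sumᴿ (map d Bs)) /ᴿ k

    ∑χA ∑χB : ℕ → ℕ
    ∑χA n = List.sum (map (λ A → χ (set A) n) As)
    ∑χB n = List.sum (map (λ B → χ (set B) n) Bs)

  open Collections public

  Below Above : Subset → Collections → Set
  Below A c = ∀ n → 1 ℕ.≤ n → ∑χA c n ℕ.≤ k c ℕ.* χ A n ℕ.+ ∑χB c n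
  Above A c = ∀ n → 1 ℕ.≤ n → k c ℕ.* χ A n ℕ.+ ∑χB c n ℕ.≤ ∑χA c n

  IsLower-d⁎ : Subset → ℝ → Set₁
  IsLower-d⁎ A = IsSup {I = Σ Collections (Below A)} λ (c , _) → quotient c

  IsUpper-d* : Subset → ℝ → Set₁
  IsUpper-d* A = IsInf {I = Σ Collections (Above A)} λ (c , _) → quotient c

{-# OPTIONS --safe #-}
module Submission where

-- Given k χ_A + Σ χ_Bj ≥ Σ χ_Ai, let F(n) be the sum of Σ χ_Ai - Σ χ_Bj over
-- [1,n] and M(n) = max (0, F(1), …, F(n)).  If F(n)/n tends to s, then M(n)/n
-- tends to max (0, s).  M is non-decreasing and grows by at most k χ_A(n) at n,
-- so ⌊M/k⌋ grows by at most 1 and only at elements of A: it is the counting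
-- function of a subset of A of density max (0, s)/k ≥ s/k.  The statement on
-- outer densities follows by passing to complements.

open import Defs
open import Algebra.Properties.CommutativeSemigroup using (interchange)
open import Axiom.ExcludedMiddle using (ExcludedMiddle)
open import Data.Integer.Base using (+≤+; +[1+_]) renaming (+_ to pos)
import Data.Integer.Base as ℤ
import Data.Integer.Properties as ℤ
import Data.Integer.Solver as ℤSolver
open import Data.List.Base using (List; []; _∷_; _++_; map; replicate)
open import Data.List.Properties using (map-++; map-replicate)
open import Data.Nat.Base as ℕ using (ℕ; zero; suc; NonZero)
open import Data.Nat.Divisibility using (m∣m*n)
import Data.Nat.DivMod as ℕ
open import Data.Nat.ListAction using (sum)
import Data.Nat.Properties as ℕ
open import Data.Product using (∃; _×_; _,_; proj₁; proj₂)
open import Data.Rational hiding (NonZero; pos)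
open import Data.Rational.Properties
import Data.Rational.Solver as ℚSolver
import Data.Rational.Unnormalised as ℚᵘ
import Data.Rational.Unnormalised.Properties as ℚᵘ
open import Data.Sum.Base using (inj₁; inj₂)
open import Level using (Level; 0ℓ; Lift; lift)
open import Relation.Binary.PropositionalEquality
open import Relation.Nullary using (¬_; Dec; yes; no; contradiction)
open import Relation.Unary using (∅; ∁)

-- Arithmetic of fractions in ℚ.

fromℚᵘ-homo-+ : ∀ p q → fromℚᵘ p + fromℚᵘ q ≡ fromℚᵘ (p ℚᵘ.+ q)
fromℚᵘ-homo-+ p q = toℚᵘ-injective (ℚᵘ.≃-trans (toℚᵘ-homo-+ (fromℚᵘ p) (fromℚᵘ q))
  (ℚᵘ.≃-trans (ℚᵘ.+-cong (toℚᵘ-fromℚᵘ p) (toℚᵘ-fromℚᵘ q))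
    (ℚᵘ.≃-sym (toℚᵘ-fromℚᵘ (p ℚᵘ.+ q)))))

fromℚᵘ-homo-* : ∀ p q → fromℚᵘ p * fromℚᵘ q ≡ fromℚᵘ (p ℚᵘ.* q)
fromℚᵘ-homo-* p q = toℚᵘ-injective (ℚᵘ.≃-trans (toℚᵘ-homo-* (fromℚᵘ p) (fromℚᵘ q))
  (ℚᵘ.≃-trans (ℚᵘ.*-cong (toℚᵘ-fromℚᵘ p) (toℚᵘ-fromℚᵘ q))
    (ℚᵘ.≃-sym (toℚᵘ-fromℚᵘ (p ℚᵘ.* q)))))

fromℚᵘ-mono-≤ : ∀ p q → p ℚᵘ.≤ q → fromℚᵘ p ≤ fromℚᵘ q
fromℚᵘ-mono-≤ p q p≤q = toℚᵘ-cancel-≤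
  (ℚᵘ.≤-respˡ-≃ (ℚᵘ.≃-sym (toℚᵘ-fromℚᵘ p))
    (ℚᵘ.≤-respʳ-≃ (ℚᵘ.≃-sym (toℚᵘ-fromℚᵘ q)) p≤q))

/-≡ : ∀ a b c d → a ℤ.* pos (suc d) ≡ b ℤ.* pos (suc c) → a / suc c ≡ b / suc d
/-≡ a b c d eq = fromℚᵘ-cong {ℚᵘ.mkℚᵘ a c} {ℚᵘ.mkℚᵘ b d} (ℚᵘ.*≡* eq)

/-≤ : ∀ a b c d → a ℕ.* suc d ℕ.≤ b ℕ.* suc c → pos a / suc c ≤ pos b / suc d
/-≤ a b c d le = fromℚᵘ-mono-≤ (ℚᵘ.mkℚᵘ (pos a) c) (ℚᵘ.mkℚᵘ (pos b) d)
  (ℚᵘ.*≤* (subst₂ ℤ._≤_ (ℤ.pos-* a (suc d)) (ℤ.pos-* b (suc c)) (+≤+ le)))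

ι : ℕ → ℚ
ι n = pos n / 1

/-distribʳ-+ : ∀ a b n .{{_ : NonZero n}} → pos (a ℕ.+ b) / n ≡ pos a / n + pos b / n
/-distribʳ-+ a b (suc n) = sym (trans
  (fromℚᵘ-homo-+ (ℚᵘ.mkℚᵘ (pos a) n) (ℚᵘ.mkℚᵘ (pos b) n))
  (/-≡ (pos a ℤ.* pos (suc n) ℤ.+ pos b ℤ.* pos (suc n)) (pos (a ℕ.+ b)) _ n
    (solve 3 (λ x y d → (x :* d :+ y :* d) :* d := (x :+ y) :* (d :* d)) refl
      (pos a) (pos b) (pos (suc n)))))
  where open ℤSolver.+-*-Solver using (solve; _:+_; _:*_; _:=_; con)

/≡ι*1/ : ∀ a n .{{_ : NonZero n}} → pos a / n ≡ ι a * (pos 1 / n)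
/≡ι*1/ a (suc n) = sym (trans
  (fromℚᵘ-homo-* (ℚᵘ.mkℚᵘ (pos a) 0) (ℚᵘ.mkℚᵘ (pos 1) n))
  (/-≡ (pos a ℤ.* pos 1) (pos a) _ n
    (solve 2 (λ x d → (x :* con (pos 1)) :* d := x :* (con (pos 1) :* d)) refl
      (pos a) (pos (suc n)))))
  where open ℤSolver.+-*-Solver using (solve; _:+_; _:*_; _:=_; con)

n/n≡1 : ∀ n .{{_ : NonZero n}} → pos n / n ≡ 1ℚ
n/n≡1 (suc n) = /-≡ (pos (suc n)) (pos 1) n 0 (ℤ.*-comm (pos (suc n)) (pos 1))

ι*1/n≡1 : ∀ n .{{_ : NonZero n}} → ι n * (pos 1 / n) ≡ 1ℚ
ι*1/n≡1 n = trans (sym (/≡ι*1/ n n)) (n/n≡1 n)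

/-monoˡ-≤ : ∀ {a b} n .{{_ : NonZero n}} → a ℕ.≤ b → pos a / n ≤ pos b / n
/-monoˡ-≤ {a} {b} (suc n) a≤b = /-≤ a b n n (ℕ.*-monoˡ-≤ (suc n) a≤b)

ι-homo-+ : ∀ a b → ι (a ℕ.+ b) ≡ ι a + ι b
ι-homo-+ a b = /-distribʳ-+ a b 1

ι-homo-* : ∀ a b → ι (a ℕ.* b) ≡ ι a * ι b
ι-homo-* a b = sym (trans (fromℚᵘ-homo-* (ℚᵘ.mkℚᵘ (pos a) 0) (ℚᵘ.mkℚᵘ (pos b) 0))
  (cong (_/ 1) (sym (ℤ.pos-* a b))))

0≤/ : ∀ a n .{{_ : NonZero n}} → 0ℚ ≤ pos a / n
0≤/ a n = nonNegative⁻¹ _ {{normalize-nonNeg a n}}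

archimedean : ∀ c ε → 0ℚ < ε → ∃ λ N → ∀ n → N ℕ.≤ n → pos c / suc n ≤ ε
-- With ε = (p+1)/(d+1), clearing denominators leaves c (d+1) ≤ (p+1)(n+1), and `n` at least c (d+1)
-- is enough for that.
archimedean c ε@(mkℚ +[1+ p ] d _) _ = c ℕ.* suc d , λ n N≤n →
  subst (pos c / suc n ≤_) (fromℚᵘ-toℚᵘ ε)
    (/-≤ c (suc p) n d (ℕ.≤-trans N≤n (ℕ.≤-trans (ℕ.n≤1+n n) (ℕ.m≤m+n (suc n) (p ℕ.* suc n)))))
archimedean c (mkℚ (pos 0) d _) (*<* (ℤ.+<+ ()))
archimedean c (mkℚ (ℤ.-[1+ p ]) d _) (*<* ())

-- Inequalities up to ε between rational sequences.

open ℚSolver.+-*-Solver using (solve; _:+_; _:*_; _:-_; :-_; _:=_; con)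

-- Rearranges an inequality in one step: two inequalities with the same slack are equivalent, and
-- equality of the slacks is a ring identity left to the solver.
p-q≡s-r⇒r≤s : ∀ {p q r s} → q ≤ p → p - q ≡ s - r → r ≤ s
p-q≡s-r⇒r≤s {p} {q} {r} {s} q≤p eq = subst₂ _≤_ (+-identityˡ r) s-r+r≡s (+-monoˡ-≤ r 0≤s-r)
  where
  0≤s-r : 0ℚ ≤ s - r
  0≤s-r = subst₂ _≤_ (+-inverseʳ q) eq (+-monoˡ-≤ (- q) q≤p)
  s-r+r≡s : (s - r) + r ≡ s
  s-r+r≡s = solve 2 (λ s r → (s :- r) :+ r := s) refl s r

0<½ε : ∀ {ε} → 0ℚ < ε → 0ℚ < ½ * ε
0<½ε {ε} 0<ε = subst (_< ½ * ε) (*-zeroʳ ½) (*-monoʳ-<-pos ½ 0<ε)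

½+½ : ∀ ε → ½ * ε + ½ * ε ≡ ε
½+½ ε = trans (sym (*-distribʳ-+ ε ½ ½)) (*-identityˡ ε)

≤-+ε : ∀ p {ε} → 0ℚ < ε → p ≤ p + ε
≤-+ε p {ε} 0<ε = subst (_≤ p + ε) (+-identityʳ p) (+-monoʳ-≤ p (<⇒≤ 0<ε))

≤-½-trans : ∀ {p q} r ε → p ≤ q + ½ * ε → q ≤ r + ½ * ε → p ≤ r + ε
≤-½-trans r ε p≤q q≤r = ≤-trans p≤q (≤-trans (+-monoˡ-≤ (½ * ε) q≤r)
  (≤-reflexive (trans (+-assoc r (½ * ε) (½ * ε)) (cong (r +_) (½+½ ε)))))

-- x ≤ᴿ y unfolds to the field type for the approximating sequences; the
-- record keeps both sequences inferable.
infix 4 _≲_ _≈_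

record _≲_ (a b : ℕ → ℚ) : Set where
  constructor mk≲
  field
    eventually : ∀ ε → 0ℚ < ε → ∃ λ N → ∀ n → N ℕ.≤ n → a n ≤ b n + ε

open _≲_ public

_≈_ : (ℕ → ℚ) → (ℕ → ℚ) → Set
a ≈ b = a ≲ b × b ≲ a

≤⇒≲ : ∀ {a b} → (∀ n → a n ≤ b n) → a ≲ b
≤⇒≲ a≤b = mk≲ λ ε 0<ε → 0 , λ n _ → ≤-trans (a≤b n) (≤-+ε _ 0<ε)

≡⇒≲ : ∀ {a b} → (∀ n → a n ≡ b n) → a ≲ b
≡⇒≲ a≡b = ≤⇒≲ λ n → ≤-reflexive (a≡b n)

≡⇒≈ : ∀ {a b} → (∀ n → a n ≡ b n) → a ≈ b
≡⇒≈ a≡b = ≡⇒≲ a≡b , ≡⇒≲ (λ n → sym (a≡b n))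

≲-trans : ∀ {a b c} → a ≲ b → b ≲ c → a ≲ c
≲-trans {c = c} a≲b b≲c = mk≲ λ ε 0<ε →
  let N₁ , p = eventually a≲b (½ * ε) (0<½ε 0<ε)
      N₂ , q = eventually b≲c (½ * ε) (0<½ε 0<ε)
  in N₁ ℕ.+ N₂ , λ n N≤n →
    ≤-½-trans (c n) ε (p n (ℕ.m+n≤o⇒m≤o N₁ N≤n)) (q n (ℕ.m+n≤o⇒n≤o N₁ N≤n))

≈-refl : ∀ {a} → a ≈ a
≈-refl = ≡⇒≈ λ _ → refl

≈-trans : ∀ {a b c} → a ≈ b → b ≈ c → a ≈ c
≈-trans (p , q) (r , s) = ≲-trans p r , ≲-trans s q

≲-+ : ∀ {a b c e} → a ≲ b → c ≲ e → (λ n → a n + c n) ≲ (λ n → b n + e n)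
≲-+ {b = b} {e = e} a≲b c≲e = mk≲ λ ε 0<ε →
  let N₁ , p = eventually a≲b (½ * ε) (0<½ε 0<ε)
      N₂ , q = eventually c≲e (½ * ε) (0<½ε 0<ε)
  in N₁ ℕ.+ N₂ , λ n N≤n → ≤-trans
    (+-mono-≤ (p n (ℕ.m+n≤o⇒m≤o N₁ N≤n)) (q n (ℕ.m+n≤o⇒n≤o N₁ N≤n)))
    (≤-reflexive (solve 3 (λ b e ε →
      (b :+ con ½ :* ε) :+ (e :+ con ½ :* ε) := b :+ e :+ ε) refl (b n) (e n) ε))

≈-+ : ∀ {a b c e} → a ≈ b → c ≈ e → (λ n → a n + c n) ≈ (λ n → b n + e n)
≈-+ (p , q) (r , s) = ≲-+ p r , ≲-+ q s

≲-neg : ∀ {a b} → a ≲ b → (λ n → - b n) ≲ (λ n → - a n)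
≲-neg {a} {b} a≲b = mk≲ λ ε 0<ε →
  let N , p = eventually a≲b ε 0<ε
  in N , λ n N≤n → p-q≡s-r⇒r≤s (p n N≤n)
    (solve 3 (λ a b ε → (b :+ ε) :- a := (:- a :+ ε) :- (:- b)) refl (a n) (b n) ε)

≈-neg : ∀ {a b} → a ≈ b → (λ n → - a n) ≈ (λ n → - b n)
≈-neg (p , q) = ≲-neg q , ≲-neg p

1/k≤1 : ∀ k .{{_ : NonZero k}} → pos 1 / k ≤ 1ℚ
1/k≤1 (suc k) = /-≤ 1 1 k 0 (ℕ.s≤s ℕ.z≤n)

-- Since 1/k ≤ 1, scaling shrinks the error, so the threshold for ε serves unchanged.
≲-/ : ∀ {a b} k .{{_ : NonZero k}} → a ≲ b → (λ n → a n * (pos 1 / k)) ≲ (λ n → b n * (pos 1 / k))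
≲-/ {a} {b} k a≲b = mk≲ λ ε 0<ε →
  let N , p = eventually a≲b ε 0<ε
      r = pos 1 / k
  in N , λ n N≤n → begin
    a n * r          ≤⟨ *-monoʳ-≤-nonNeg r {{normalize-nonNeg 1 k}} (p n N≤n) ⟩
    (b n + ε) * r    ≡⟨ *-distribʳ-+ r (b n) ε ⟩
    b n * r + ε * r  ≤⟨ +-monoʳ-≤ (b n * r) (*-monoˡ-≤-nonNeg ε {{pos⇒nonNeg ε {{positive 0<ε}}}} (1/k≤1 k)) ⟩
    b n * r + ε * 1ℚ ≡⟨ cong (b n * r +_) (*-identityʳ ε) ⟩
    b n * r + ε      ∎
  where open ≤-Reasoning

≈-/ : ∀ {a b} k .{{_ : NonZero k}} → a ≈ b → (λ n → a n * (pos 1 / k)) ≈ (λ n → b n * (pos 1 / k))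
≈-/ k (p , q) = ≲-/ k p , ≲-/ k q

-- The map max (0, ·) is monotone and 1-Lipschitz, so it passes the error on without enlarging it.
≲-0⊔ : ∀ {a b} → a ≲ b → (λ n → 0ℚ ⊔ a n) ≲ (λ n → 0ℚ ⊔ b n)
≲-0⊔ {b = b} a≲b = mk≲ λ ε 0<ε →
  let N , p = eventually a≲b ε 0<ε
  in N , λ n N≤n → ⊔-lub
    (≤-trans (p≤p⊔q 0ℚ (b n)) (≤-+ε _ 0<ε))
    (≤-trans (p n N≤n) (+-monoˡ-≤ ε (p≤q⊔p 0ℚ (b n))))

≈-0⊔ : ∀ {a b} → a ≈ b → (λ n → 0ℚ ⊔ a n) ≈ (λ n → 0ℚ ⊔ b n)
≈-0⊔ (p , q) = ≲-0⊔ p , ≲-0⊔ q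

c/n≲0 : ∀ c → (λ n → pos c / suc n) ≲ (λ _ → 0ℚ)
c/n≲0 c = mk≲ λ ε 0<ε → let N , p = archimedean c ε 0<ε in
  N , λ n N≤n → ≤-trans (p n N≤n) (≤-reflexive (sym (+-identityˡ ε)))

-- Cauchy sequences and limits.

Cauchy≤ : (ℕ → ℚ) → Set
Cauchy≤ a = ∀ ε → 0ℚ < ε → ∃ λ N → ∀ m n → N ℕ.≤ m → N ℕ.≤ n → a m ≤ a n + ε

IsCauchy⇒Cauchy≤ : ∀ {a} → IsCauchy a → Cauchy≤ a
IsCauchy⇒Cauchy≤ {a} ca ε 0<ε = let N , p = ca ε 0<ε in
  N , λ m n N≤m N≤n → p-q≡s-r⇒r≤s (≤-trans (p≤∣p∣ (a m - a n)) (p m n N≤m N≤n))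
    (solve 3 (λ a b ε → ε :- (a :- b) := (b :+ ε) :- a) refl (a m) (a n) ε)
  where
  p≤∣p∣ : ∀ p → p ≤ ∣ p ∣
  p≤∣p∣ p with ≤-total 0ℚ p
  ... | inj₁ 0≤p = ≤-reflexive (sym (0≤p⇒∣p∣≡p 0≤p))
  ... | inj₂ p≤0 = ≤-trans p≤0 (0≤∣p∣ p)

∣p-q∣≤ : ∀ {p q ε} → p ≤ q + ε → q ≤ p + ε → ∣ p - q ∣ ≤ ε
∣p-q∣≤ {p} {q} {ε} p≤ q≤ with ∣p∣≡p∨∣p∣≡-p (p - q)
... | inj₁ eq = subst (_≤ ε) (sym eq) (p-q≡s-r⇒r≤s p≤
  (solve 3 (λ p q ε → (q :+ ε) :- p := ε :- (p :- q)) refl p q ε))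
... | inj₂ eq = subst (_≤ ε) (sym eq) (p-q≡s-r⇒r≤s q≤
  (solve 3 (λ p q ε → (p :+ ε) :- q := ε :- (:- (p :- q))) refl p q ε))

-- Both indices range over the same tail, so exchanging them supplies the reverse bound.
Cauchy≤⇒IsCauchy : ∀ {a} → Cauchy≤ a → IsCauchy a
Cauchy≤⇒IsCauchy ca ε 0<ε = let N , p = ca ε 0<ε in
  N , λ m n N≤m N≤n → ∣p-q∣≤ (p m n N≤m N≤n) (p n m N≤n N≤m)

cauchy≤ : ∀ x → Cauchy≤ (approx x)
cauchy≤ x = IsCauchy⇒Cauchy≤ (cauchy x)

max0 : ℝ → ℝ
max0 x = mkℝ (λ n → 0ℚ ⊔ approx x n) (Cauchy≤⇒IsCauchy λ ε 0<ε →
  let N , p = cauchy≤ x ε 0<ε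
  in N , λ m n N≤m N≤n → ⊔-lub
    (≤-trans (p≤p⊔q 0ℚ (approx x n)) (≤-+ε _ 0<ε))
    (≤-trans (p m n N≤m N≤n) (+-monoˡ-≤ ε (p≤q⊔p 0ℚ (approx x n)))))

-- A limit compares `a n` with `approx x m` for all large `m`. The Cauchy property moves `m` to `n`,
-- which turns the double limit into a comparison along the diagonal.
⟶⇒≈ : ∀ {a} x → a ⟶ x → a ≈ approx x
⟶⇒≈ {a} x lim = mk≲ (λ ε 0<ε → let N , p = bound ε 0<ε in N , λ n N≤n → proj₁ (p n N≤n))
              , mk≲ (λ ε 0<ε → let N , p = bound ε 0<ε in N , λ n N≤n → proj₂ (p n N≤n))
  where
  bound : ∀ ε → 0ℚ < ε → ∃ λ N → ∀ n → N ℕ.≤ n →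
    a n ≤ approx x n + ε × approx x n ≤ a n + ε
  bound ε 0<ε =
    -- One `ε₂` pays for the tolerance of the limit, the other for the real inequality that
    -- expresses it, and `ε₁` for the move from `m` to `n`.
    let ε₁ = ½ * ε
        ε₂ = ½ * ε₁
        0<ε₁ = 0<½ε 0<ε
        0<ε₂ = 0<½ε 0<ε₁
        N₁ , p = lim ε₂ 0<ε₂
        N₂ , q = cauchy≤ x ε₁ 0<ε₁
    in N₁ ℕ.+ N₂ , λ n N≤n →
      let N₁≤n = ℕ.m+n≤o⇒m≤o N₁ N≤n
          N₂≤n = ℕ.m+n≤o⇒n≤o N₁ N≤n
          M₁ , r = proj₁ (p n N₁≤n) ε₂ 0<ε₂
          M₂ , s = proj₂ (p n N₁≤n) ε₂ 0<ε₂
          m₁ = M₁ ℕ.+ N₂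
          m₂ = M₂ ℕ.+ N₂
          xₙ≥ = q m₁ n (ℕ.m≤n+m N₂ M₁) N₂≤n
          xₙ≤ = q n m₂ N₂≤n (ℕ.m≤n+m N₂ M₂)
          combine : ∀ z → z + ε₂ + ε₂ ≡ z + ε₁
          combine = λ z → trans (+-assoc z ε₂ ε₂) (cong (z +_) (½+½ ε₁))
      in ≤-½-trans (approx x n) ε (subst (a n ≤_) (combine (approx x m₁)) (r m₁ (ℕ.m≤m+n M₁ N₂))) xₙ≥
       , ≤-½-trans (a n) ε xₙ≤ (subst (approx x m₂ ≤_) (combine (a n)) (s m₂ (ℕ.m≤m+n M₂ N₂)))

-- The Cauchy property carries the comparison at index `n` over to every `m` in the tail, which is
-- what the real inequality for a fixed `n` asks.
≈⇒⟶ : ∀ {a} x → a ≈ approx x → a ⟶ x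
≈⇒⟶ {a} x (a≲x , x≲a) ε 0<ε =
  let N₁ , p = eventually a≲x (½ * ε) (0<½ε 0<ε)
      N₂ , q = eventually x≲a (½ * ε) (0<½ε 0<ε)
      N₃ , r = cauchy≤ x (½ * ε) (0<½ε 0<ε)
  in N₁ ℕ.+ N₂ ℕ.+ N₃ , λ n N≤n →
    let N₁₂≤n = ℕ.m+n≤o⇒m≤o (N₁ ℕ.+ N₂) N≤n
        N₁≤n = ℕ.m+n≤o⇒m≤o N₁ N₁₂≤n
        N₂≤n = ℕ.m+n≤o⇒n≤o N₁ N₁₂≤n
        N₃≤n = ℕ.m+n≤o⇒n≤o (N₁ ℕ.+ N₂) N≤n
    in (λ δ 0<δ → N₃ , λ m N₃≤m →
         ≤-trans (≤-½-trans (approx x m) ε (p n N₁≤n) (r n m N₃≤n N₃≤m)) (≤-+ε _ 0<δ))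
     , (λ δ 0<δ → N₃ , λ m N₃≤m →
         ≤-trans (≤-½-trans (a n) ε (r m n N₃≤m N₃≤n) (q n N₂≤n)) (≤-+ε _ 0<δ))

-- Means of integer sequences.

cumulative : (ℕ → ℕ) → ℕ → ℕ
cumulative f zero    = 0
cumulative f (suc n) = cumulative f n ℕ.+ f (suc n)

-- Indexed with the same shift as the sequence in HasDensity.
mean : (ℕ → ℕ) → ℕ → ℚ
mean f n = pos (f (suc n)) / suc n

q/n≤r⇒q≤n*r : ∀ q n .{{_ : NonZero n}} {r} → pos q / n ≤ r → ι q ≤ ι n * r
q/n≤r⇒q≤n*r q n {r} q/n≤r = begin
  ι q                     ≡⟨ *-identityʳ (ι q) ⟨
  ι q * 1ℚ                ≡⟨ cong (ι q *_) (ι*1/n≡1 n) ⟨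
  ι q * (ι n * (pos 1 / n)) ≡⟨ solve 3 (λ q n i → q :* (n :* i) := n :* (q :* i)) refl (ι q) (ι n) (pos 1 / n) ⟩
  ι n * (ι q * (pos 1 / n)) ≡⟨ cong (ι n *_) (/≡ι*1/ q n) ⟨
  ι n * (pos q / n)         ≤⟨ *-monoˡ-≤-nonNeg (ι n) {{normalize-nonNeg n 1}} q/n≤r ⟩
  ι n * r                 ∎
  where open ≤-Reasoning

q≤c+n*r⇒q/n≤c/n+r : ∀ q c n .{{_ : NonZero n}} {r} → ι q ≤ ι c + ι n * r → pos q / n ≤ pos c / n + r
q≤c+n*r⇒q/n≤c/n+r q c n {r} q≤ = begin
  pos q / n                     ≡⟨ /≡ι*1/ q n ⟩
  ι q * i                       ≤⟨ *-monoʳ-≤-nonNeg i {{normalize-nonNeg 1 n}} q≤ ⟩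
  (ι c + ι n * r) * i
    ≡⟨ solve 4 (λ c n r i → (c :+ n :* r) :* i := c :* i :+ (n :* i) :* r) refl (ι c) (ι n) r i ⟩
  ι c * i + (ι n * i) * r       ≡⟨ cong₂ (λ x y → x + y * r) (/≡ι*1/ c n) (sym (ι*1/n≡1 n)) ⟨
  pos c / n + 1ℚ * r            ≡⟨ cong (λ x → pos c / n + x) (*-identityˡ r) ⟩
  pos c / n + r                 ∎
  where
  open ≤-Reasoning
  i = pos 1 / n

q*k/n/k≡q/n : ∀ q k n .{{_ : NonZero k}} .{{_ : NonZero n}} →
  (pos (q ℕ.* k) / n) * (pos 1 / k) ≡ pos q / n
q*k/n/k≡q/n q k n = begin
  (pos (q ℕ.* k) / n) * j  ≡⟨ cong (_* j) (/≡ι*1/ (q ℕ.* k) n) ⟩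
  (ι (q ℕ.* k) * i) * j    ≡⟨ cong (λ z → (z * i) * j) (ι-homo-* q k) ⟩
  ((ι q * ι k) * i) * j
    ≡⟨ solve 4 (λ q k i j → ((q :* k) :* i) :* j := (k :* j) :* (q :* i)) refl (ι q) (ι k) i j ⟩
  (ι k * j) * (ι q * i)    ≡⟨ cong₂ _*_ (ι*1/n≡1 k) (sym (/≡ι*1/ q n)) ⟩
  1ℚ * (pos q / n)         ≡⟨ *-identityˡ (pos q / n) ⟩
  pos q / n                ∎
  where
  open ≡-Reasoning
  i = pos 1 / n
  j = pos 1 / k

-- Truncation at 0 is unaffected by dividing by a positive number; this is how max (0, s) enters the
-- limit.
/-distrib-∸ : ∀ p q n .{{_ : NonZero n}} → pos (p ℕ.∸ q) / n ≡ 0ℚ ⊔ (pos p / n - pos q / n)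
/-distrib-∸ p q n with ℕ.≤-total q p
... | inj₁ q≤p = trans x≡ (sym (p≤q⇒p⊔q≡q (subst (0ℚ ≤_) x≡ (0≤/ (p ℕ.∸ q) n))))
  where
  x = pos (p ℕ.∸ q) / n
  y = pos q / n
  x≡ : x ≡ pos p / n - y
  x≡ = trans (solve 2 (λ x y → x := (x :+ y) :- y) refl x y)
    (cong (_- y) (trans (sym (/-distribʳ-+ (p ℕ.∸ q) q n)) (cong (λ m → pos m / n) (ℕ.m∸n+n≡m q≤p))))
... | inj₂ p≤q = trans (cong (λ m → pos m / n) (ℕ.m≤n⇒m∸n≡0 p≤q)) (trans (0/n≡0 n)
  (sym (p≥q⇒p⊔q≡p (subst₂ _≤_ refl (+-inverseʳ (pos q / n)) (+-monoˡ-≤ (- (pos q / n)) (/-monoˡ-≤ n p≤q))))))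

-- Rounding down loses less than 1 at each index, hence at most 1/(n+1) in the mean, and this tends
-- to 0.
mean-/ : ∀ f k .{{_ : NonZero k}} → mean (λ n → f n ℕ./ k) ≈ (λ n → mean f n * (pos 1 / k))
mean-/ f k = ≤⇒≲ lower , ≲-trans (≤⇒≲ upper) (≲-trans
  (≲-+ (≤⇒≲ {b = mean (λ n → f n ℕ./ k)} λ _ → ≤-refl) (c/n≲0 1))
  (≡⇒≲ λ n → +-identityʳ _))
  where
  open ≤-Reasoning
  j = pos 1 / k
  j≥0 = normalize-nonNeg 1 k
  lower : ∀ n → pos (f (suc n) ℕ./ k) / suc n ≤ mean f n * j
  lower n = begin
    pos q / suc n                     ≡⟨ q*k/n/k≡q/n q k (suc n) ⟨
    (pos (q ℕ.* k) / suc n) * j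
      ≤⟨ *-monoʳ-≤-nonNeg j {{j≥0}} (/-monoˡ-≤ (suc n) (ℕ.m/n*n≤m (f (suc n)) k)) ⟩
    mean f n * j ∎
    where q = f (suc n) ℕ./ k
  upper : ∀ n → mean f n * j ≤ pos (f (suc n) ℕ./ k) / suc n + pos 1 / suc n
  upper n = begin
    mean f n * j                               ≤⟨ *-monoʳ-≤-nonNeg j {{j≥0}} (/-monoˡ-≤ (suc n) f≤) ⟩
    (pos ((q ℕ.+ 1) ℕ.* k) / suc n) * j        ≡⟨ q*k/n/k≡q/n (q ℕ.+ 1) k (suc n) ⟩
    pos (q ℕ.+ 1) / suc n                      ≡⟨ /-distribʳ-+ q 1 (suc n) ⟩
    pos q / suc n + pos 1 / suc n              ∎
    where
    q = f (suc n) ℕ./ k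
    f≤ : f (suc n) ℕ.≤ (q ℕ.+ 1) ℕ.* k
    f≤ = ℕ.≤-trans (ℕ.≤-reflexive (ℕ.m≡m%n+[m/n]*n (f (suc n)) k))
      (ℕ.≤-trans (ℕ.+-monoˡ-≤ (q ℕ.* k) (ℕ.<⇒≤ (ℕ.m%n<n (f (suc n)) k)))
        (ℕ.≤-reflexive (cong (ℕ._* k) (ℕ.+-comm 1 q))))

-- Running maxima.

runningMax : (f : ℕ → ℕ) → ℕ → ℕ
runningMax f zero    = 0
runningMax f (suc n) = runningMax f n ℕ.⊔ f (suc n)

-- Past `N` all values lie under the non-decreasing line of slope `r` through the origin, so only
-- the maximum reached by `N` has to be added. That constant vanishes on division by `n`.
runningMax-linear : ∀ f N {r} → 0ℚ ≤ r → (∀ m → N ℕ.≤ m → mean f m ≤ r) →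
  ∀ j → ι (runningMax f (j ℕ.+ N)) ≤ ι (runningMax f N) + ι (j ℕ.+ N) * r
runningMax-linear f N {r} 0≤r f≤ zero = begin
  ι (runningMax f N)            ≡⟨ +-identityʳ _ ⟨
  ι (runningMax f N) + 0ℚ       ≤⟨ +-monoʳ-≤ (ι (runningMax f N)) 0≤N*r ⟩
  ι (runningMax f N) + ι N * r  ∎
  where
  open ≤-Reasoning
  0≤N*r : 0ℚ ≤ ι N * r
  0≤N*r = nonNegative⁻¹ _ {{nonNeg*nonNeg⇒nonNeg (ι N) {{normalize-nonNeg N 1}} r {{nonNegative 0≤r}}}}
runningMax-linear f N {r} 0≤r f≤ (suc j) with ℕ.⊔-sel (runningMax f (j ℕ.+ N)) (f (suc j ℕ.+ N))
... | inj₁ eq = begin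
  ι (runningMax f (j ℕ.+ N) ℕ.⊔ f (suc j ℕ.+ N)) ≡⟨ cong ι eq ⟩
  ι (runningMax f (j ℕ.+ N))                     ≤⟨ runningMax-linear f N 0≤r f≤ j ⟩
  ι (runningMax f N) + ι (j ℕ.+ N) * r
    ≤⟨ +-monoʳ-≤ (ι (runningMax f N))
        (*-monoʳ-≤-nonNeg r {{nonNegative 0≤r}} (/-monoˡ-≤ 1 (ℕ.n≤1+n (j ℕ.+ N)))) ⟩
  ι (runningMax f N) + ι (suc j ℕ.+ N) * r       ∎
  where open ≤-Reasoning
... | inj₂ eq = begin
  ι (runningMax f (j ℕ.+ N) ℕ.⊔ f (suc j ℕ.+ N)) ≡⟨ cong ι eq ⟩
  ι (f (suc j ℕ.+ N))
    ≤⟨ q/n≤r⇒q≤n*r (f (suc j ℕ.+ N)) (suc j ℕ.+ N) (f≤ (j ℕ.+ N) (ℕ.m≤n+m N j)) ⟩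
  ι (suc j ℕ.+ N) * r                            ≡⟨ +-identityˡ _ ⟨
  0ℚ + ι (suc j ℕ.+ N) * r                       ≤⟨ +-monoˡ-≤ (ι (suc j ℕ.+ N) * r) (0≤/ (runningMax f N) 1) ⟩
  ι (runningMax f N) + ι (suc j ℕ.+ N) * r       ∎
  where open ≤-Reasoning

-- The Cauchy property keeps all `v m` past a fixed `N` close to `v n`, so early values of `f` past
-- `N` also lie under a line whose slope is nearly `v n`.
mean-runningMax-≲ : ∀ f {v} → (∀ n → 0ℚ ≤ v n) → Cauchy≤ v → mean f ≲ v → mean (runningMax f) ≲ v
mean-runningMax-≲ f {v} 0≤v cv f≲v = mk≲ λ ε 0<ε →
  let ε₁ = ½ * ε
      ε₂ = ½ * ε₁
      0<ε₁ = 0<½ε 0<ε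
      0<ε₂ = 0<½ε 0<ε₁
      N₁ , p = eventually f≲v ε₂ 0<ε₂
      N₂ , q = cv ε₂ 0<ε₂
      N = N₁ ℕ.+ N₂
      N₃ , r = archimedean (runningMax f N) ε₁ 0<ε₁
  in N ℕ.+ N₃ , λ n N≤n →
    let N≤n′ = ℕ.m+n≤o⇒m≤o N N≤n
        -- The slope `v n + ε₁` varies with `n`, while `N`, and with it the constant
        -- `runningMax f N`, stays fixed.
        f≤ = λ m N≤m → ≤-½-trans (v n) ε₁
          (p m (ℕ.m+n≤o⇒m≤o N₁ N≤m))
          (q m n (ℕ.m+n≤o⇒n≤o N₁ N≤m) (ℕ.m+n≤o⇒n≤o N₁ N≤n′))
        linear = subst (λ m → ι (runningMax f m) ≤ ι (runningMax f N) + ι m * (v n + ε₁))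
          (ℕ.m∸n+n≡m (ℕ.m≤n⇒m≤1+n N≤n′))
          (runningMax-linear f N (≤-trans (0≤v n) (≤-+ε (v n) 0<ε₁)) f≤ (suc n ℕ.∸ N))
    in begin
      mean (runningMax f) n
        ≤⟨ q≤c+n*r⇒q/n≤c/n+r (runningMax f (suc n)) (runningMax f N) (suc n) linear ⟩
      pos (runningMax f N) / suc n + (v n + ε₁)      ≤⟨ +-monoˡ-≤ (v n + ε₁) (r n (ℕ.m+n≤o⇒n≤o N N≤n)) ⟩
      ε₁ + (v n + ε₁)
        ≡⟨ solve 2 (λ v ε → con ½ :* ε :+ (v :+ con ½ :* ε) := v :+ ε) refl (v n) ε ⟩
      v n + ε                                        ∎
  where open ≤-Reasoning

mean-runningMax : ∀ f {v} → (∀ n → 0ℚ ≤ v n) → Cauchy≤ v → mean f ≈ v → mean (runningMax f) ≈ v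
mean-runningMax f 0≤v cv (f≲v , v≲f) = mean-runningMax-≲ f 0≤v cv f≲v ,
  ≲-trans v≲f (≤⇒≲ λ n → /-monoˡ-≤ (suc n) (ℕ.m≤n⊔m (runningMax f n) (f (suc n))))

-- Excess of one cumulative sum over another.

module _ (f g : ℕ → ℕ) where

  -- Replacing negative differences by 0 does not change the running maximum, which starts at 0, and
  -- keeps everything in ℕ.
  excess : ℕ → ℕ
  excess n = cumulative f n ℕ.∸ cumulative g n

  excess≤runningMax : ∀ n → excess n ℕ.≤ runningMax excess n
  excess≤runningMax zero    = ℕ.z≤n
  excess≤runningMax (suc n) = ℕ.m≤n⊔m (runningMax excess n) (excess (suc n))

  -- The previous difference is at most the old maximum and one step raises it by at most `c`, so a
  -- new record exceeds the old one by at most `c`.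
  runningMax-step : ∀ n {c} → f (suc n) ℕ.≤ c ℕ.+ g (suc n) →
    runningMax excess (suc n) ℕ.≤ runningMax excess n ℕ.+ c
  runningMax-step n {c} f≤ = ℕ.⊔-lub (ℕ.m≤m+n M c) (ℕ.m≤n+o⇒m∸n≤o
    (F ℕ.+ f (suc n)) (G ℕ.+ g (suc n)) (begin
    F ℕ.+ f (suc n)                     ≤⟨ ℕ.+-mono-≤ F≤ f≤ ⟩
    (G ℕ.+ M) ℕ.+ (c ℕ.+ g (suc n))     ≡⟨ ℕ.+-assoc G M _ ⟩
    G ℕ.+ (M ℕ.+ (c ℕ.+ g (suc n)))
      ≡⟨ cong (G ℕ.+_) (trans (sym (ℕ.+-assoc M c _)) (ℕ.+-comm (M ℕ.+ c) (g (suc n)))) ⟩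
    G ℕ.+ (g (suc n) ℕ.+ (M ℕ.+ c))     ≡⟨ ℕ.+-assoc G (g (suc n)) (M ℕ.+ c) ⟨
    (G ℕ.+ g (suc n)) ℕ.+ (M ℕ.+ c)     ∎))
    where
    open ℕ.≤-Reasoning
    M = runningMax excess n
    F = cumulative f n
    G = cumulative g n
    F≤ : F ℕ.≤ G ℕ.+ M
    F≤ = ℕ.≤-trans (ℕ.m≤n+m∸n F G) (ℕ.+-monoʳ-≤ G (excess≤runningMax n))

  mean-runningMax-excess : ∀ x → (λ n → mean (cumulative f) n - mean (cumulative g) n) ≈ approx x →
    mean (runningMax excess) ≈ approx (max0 x)
  mean-runningMax-excess x f-g≈x = mean-runningMax excess (λ n → p≤p⊔q 0ℚ (approx x n)) (cauchy≤ (max0 x))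
    (≈-trans (≡⇒≈ eq) (≈-0⊔ f-g≈x))
    where
    eq : ∀ n → mean excess n ≡ 0ℚ ⊔ (mean (cumulative f) n - mean (cumulative g) n)
    eq n = /-distrib-∸ (cumulative f (suc n)) (cumulative g (suc n)) (suc n)

-- Existence of suprema of bounded families of reals.

∀ε⇒≤ : ∀ {p q} → (∀ ε → 0ℚ < ε → p ≤ q + ε) → p ≤ q
∀ε⇒≤ {p} {q} p≤q+ε with p ≤? q
... | yes p≤q = p≤q
... | no p≰q =
  -- For `m` strictly between `q` and `p`, the choice ε = m - q would give p ≤ m.
  let m , q<m , m<p = <-dense (≰⇒> p≰q)
      p≤m = subst (p ≤_) (solve 2 (λ q m → q :+ (m :- q) := m) refl q m)
        (p≤q+ε (m - q) (subst (_< m - q) (+-inverseʳ q) (+-monoˡ-< (- q) q<m)))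
  in contradiction (<-≤-trans m<p p≤m) (<-irrefl refl)

≤ᴿ-trans : ∀ x y z → x ≤ᴿ y → y ≤ᴿ z → x ≤ᴿ z
≤ᴿ-trans x y z x≤y y≤z = eventually (≲-trans (mk≲ {approx x} {approx y} x≤y) (mk≲ {approx y} {approx z} y≤z))

module _ (em : ExcludedMiddle (Level.suc 0ℓ)) {I : Set₁} (f : I → ℝ)
  (i₀ : I) (0≤fi₀ : fromℚ 0ℚ ≤ᴿ f i₀) (f≤1 : ∀ i → f i ≤ᴿ fromℚ 1ℚ) where

  private
    -- Quantifying over `I` puts this in `Set₁`, the level at which excluded middle is available.
    UpperBound : ℚ → Set₁
    UpperBound q = ∀ i → f i ≤ᴿ fromℚ q

    0≤upperBound : ∀ {r} → UpperBound r → 0ℚ ≤ r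
    0≤upperBound {r} ub = ∀ε⇒≤ λ ε 0<ε →
      let N , p = ≤ᴿ-trans (fromℚ 0ℚ) (f i₀) (fromℚ r) 0≤fi₀ (ub i₀) ε 0<ε in p N ℕ.≤-refl

    upperBound-mono : ∀ {p q} → p ≤ q → UpperBound p → UpperBound q
    upperBound-mono {p} {q} p≤q ub i =
      ≤ᴿ-trans (f i) (fromℚ p) (fromℚ q) (ub i) (eventually (≤⇒≲ λ _ → p≤q))

    -- Descending along the grid of mesh 1/(n+1), excluded middle finds the last
    -- upper bound; these approximate the supremum without any bisection.
    leastGridBound : ∀ n j → UpperBound (pos j / suc n) →
      ∃ λ u → UpperBound u × (∀ r → UpperBound r → u ≤ r + pos 1 / suc n)
    leastGridBound n zero ub = pos 0 / suc n , ub , λ r ubr → begin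
      pos 0 / suc n       ≡⟨ 0/n≡0 (suc n) ⟩
      0ℚ                  ≤⟨ 0≤upperBound ubr ⟩
      r                   ≡⟨ +-identityʳ r ⟨
      r + 0ℚ              ≤⟨ +-monoʳ-≤ r (0≤/ 1 (suc n)) ⟩
      r + pos 1 / suc n   ∎
      where open ≤-Reasoning
    leastGridBound n (suc j) ub with em {UpperBound (pos j / suc n)}
    ... | yes ub′ = leastGridBound n j ub′
    ... | no ¬ub  = pos (suc j) / suc n , ub , λ r ubr → ≤-trans
      (≤-reflexive (trans (/-distribʳ-+ 1 j (suc n)) (+-comm (pos 1 / suc n) (pos j / suc n))))
      (+-monoˡ-≤ (pos 1 / suc n) (j≤ r ubr))
      where
      j≤ : ∀ r → UpperBound r → pos j / suc n ≤ r
      j≤ r ubr with ≤-total r (pos j / suc n)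
      ... | inj₁ r≤j = contradiction (upperBound-mono r≤j ubr) ¬ub
      ... | inj₂ j≤r = j≤r

    grid : ∀ n → ∃ λ u → UpperBound u × (∀ r → UpperBound r → u ≤ r + pos 1 / suc n)
    -- The descent starts at (n+1)/(n+1) = 1.
    grid n = leastGridBound n (suc n) (subst UpperBound (sym (n/n≡1 (suc n))) f≤1)

    u : ℕ → ℚ
    u n = proj₁ (grid n)

    u-ub : ∀ n → UpperBound (u n)
    u-ub n = proj₁ (proj₂ (grid n))

    u-least : ∀ n r → UpperBound r → u n ≤ r + pos 1 / suc n
    u-least n = proj₂ (proj₂ (grid n))

    -- Every `u n` is an upper bound, so near-minimality of `u m` yields u m ≤ u n + 1/(m+1), which
    -- is the one-sided Cauchy condition.
    supremum : ℝ
    supremum = mkℝ u (Cauchy≤⇒IsCauchy λ ε 0<ε → let N , p = archimedean 1 ε 0<ε in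
      N , λ m n N≤m _ → ≤-trans (u-least m (u n) (u-ub n)) (+-monoʳ-≤ (u n) (p m N≤m)))

  sup-exists : ∃ λ x → IsSup f x
  sup-exists = supremum , bound , least
    where
    bound : ∀ i → f i ≤ᴿ supremum
    bound i ε 0<ε =
      -- The threshold from `u-ub` depends on the bound chosen, so one fixed `u N₁` is used; it is
      -- within 1/(N₁+1) above any `u n`.
      let N₁ , p = archimedean 1 (½ * ε) (0<½ε 0<ε)
          N₂ , q = u-ub N₁ i (½ * ε) (0<½ε 0<ε)
      in N₂ , λ n N₂≤n → ≤-½-trans (u n) ε (q n N₂≤n)
        (≤-trans (u-least N₁ (u n) (u-ub n)) (+-monoʳ-≤ (u n) (p N₁ ℕ.≤-refl)))
    least : ∀ y → (∀ i → f i ≤ᴿ y) → supremum ≤ᴿ y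
    least y f≤y ε 0<ε =
      let 0<½ = 0<½ε 0<ε
          N₁ , p = cauchy≤ y (½ * ε) 0<½
          N₂ , q = archimedean 1 (½ * ε) 0<½
      in N₁ ℕ.+ N₂ , λ n N≤n →
        -- By the Cauchy property of `y`, the rational `approx y n + ½ * ε` lies above `y` and so is
        -- an upper bound, which `u n` nearly minimises.
        let ub = λ i → ≤ᴿ-trans (f i) y (fromℚ (approx y n + ½ * ε)) (f≤y i)
              (λ δ 0<δ → N₁ , λ m N₁≤m →
                ≤-trans (p m n N₁≤m (ℕ.m+n≤o⇒m≤o N₁ N≤n)) (≤-+ε _ 0<δ))
        in ≤-½-trans (approx y n) ε
          (≤-trans (u-least n (approx y n + ½ * ε) ub)
            (+-monoʳ-≤ (approx y n + ½ * ε) (q n (ℕ.m+n≤o⇒n≤o N₁ N≤n)))) ≤-refl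

-- The order-reversing reflection x ↦ 1 - x.

1-_ : (ℕ → ℚ) → ℕ → ℚ
(1- a) n = 1ℚ - a n

1-≲-swapˡ : ∀ a b → (1- a) ≲ b → (1- b) ≲ a
1-≲-swapˡ a b le = mk≲ λ ε 0<ε → let N , p = eventually le ε 0<ε in
  N , λ n N≤n → p-q≡s-r⇒r≤s (p n N≤n)
    (solve 3 (λ a b ε → (b :+ ε) :- (con 1ℚ :- a) := (a :+ ε) :- (con 1ℚ :- b)) refl (a n) (b n) ε)

1-≲-swapʳ : ∀ a b → a ≲ (1- b) → b ≲ (1- a)
1-≲-swapʳ a b le = mk≲ λ ε 0<ε → let N , p = eventually le ε 0<ε in
  N , λ n N≤n → p-q≡s-r⇒r≤s (p n N≤n)
    (solve 3 (λ a b ε → (con 1ℚ :- b :+ ε) :- a := (con 1ℚ :- a :+ ε) :- b) refl (a n) (b n) ε)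

1≈ : ∀ {a b} → a ≈ b → (1- a) ≈ (1- b)
1≈ a≈b = ≈-+ (≈-refl {λ _ → 1ℚ}) (≈-neg a≈b)

1-ᴿ_ : ℝ → ℝ
1-ᴿ x = fromℚ 1ℚ -ᴿ x

1-ᴿ-swapˡ : ∀ x y → 1-ᴿ x ≤ᴿ y → 1-ᴿ y ≤ᴿ x
1-ᴿ-swapˡ x y le = eventually (1-≲-swapˡ (approx x) (approx y) (mk≲ le))

1-ᴿ-swapʳ : ∀ x y → x ≤ᴿ 1-ᴿ y → y ≤ᴿ 1-ᴿ x
1-ᴿ-swapʳ x y le = eventually (1-≲-swapʳ (approx x) (approx y) (mk≲ le))

-- Finite sums of reals and cumulative sums.

sumᴿ-replicate-++ : ∀ k x xs n → approx x n ≡ 1ℚ →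
  approx (sumᴿ (replicate k x ++ xs)) n ≡ ι k + approx (sumᴿ xs) n
sumᴿ-replicate-++ zero    x xs n x≡1 = sym (+-identityˡ (approx (sumᴿ xs) n))
sumᴿ-replicate-++ (suc k) x xs n x≡1 = begin
  approx x n + approx (sumᴿ (replicate k x ++ xs)) n  ≡⟨ cong₂ _+_ x≡1 (sumᴿ-replicate-++ k x xs n x≡1) ⟩
  1ℚ + (ι k + s)  ≡⟨ +-assoc 1ℚ (ι k) s ⟨
  (1ℚ + ι k) + s  ≡⟨ cong (_+ s) (ι-homo-+ 1 k) ⟨
  ι (suc k) + s   ∎
  where
  open ≡-Reasoning
  s = approx (sumᴿ xs) n

mean-+ : ∀ f g n → mean (λ m → f m ℕ.+ g m) n ≡ mean f n + mean g n
mean-+ f g n = /-distribʳ-+ (f (suc n)) (g (suc n)) (suc n)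

cumulative-+ : ∀ f g n → cumulative (λ m → f m ℕ.+ g m) n ≡ cumulative f n ℕ.+ cumulative g n
cumulative-+ f g zero    = refl
cumulative-+ f g (suc n) = trans (cong (ℕ._+ (f (suc n) ℕ.+ g (suc n))) (cumulative-+ f g n))
  (interchange ℕ.+-commutativeSemigroup (cumulative f n) (cumulative g n) (f (suc n)) (g (suc n)))

cumulative-0 : ∀ n → cumulative (λ _ → 0) n ≡ 0
cumulative-0 zero    = refl
cumulative-0 (suc n) = trans (ℕ.+-identityʳ _) (cumulative-0 n)

-- Characteristic functions and sets with density.

module _ (em : ExcludedMiddle (Level.suc 0ℓ)) where
  open Density em

  dec : (A : Subset) (n : ℕ) → Dec (A n)
  dec A n with em {Lift (Level.suc 0ℓ) (A n)}
  ... | yes (lift a) = yes a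
  ... | no ¬a        = no λ a → ¬a (lift a)

  χ≡1 : ∀ A n → A n → χ A n ≡ 1
  χ≡1 A n a with em {Lift (Level.suc 0ℓ) (A n)}
  ... | yes _ = refl
  ... | no ¬a = contradiction (lift a) ¬a

  χ≡0 : ∀ A n → ¬ A n → χ A n ≡ 0
  χ≡0 A n ¬a with em {Lift (Level.suc 0ℓ) (A n)}
  ... | yes (lift a) = contradiction a ¬a
  ... | no _ = refl

  χ-mono : ∀ A B n → (A n → B n) → χ A n ℕ.≤ χ B n
  χ-mono A B n A⊆B with dec A n
  ... | yes a = ℕ.≤-reflexive (trans (χ≡1 A n a) (sym (χ≡1 B n (A⊆B a))))
  ... | no ¬a = subst (ℕ._≤ χ B n) (sym (χ≡0 A n ¬a)) ℕ.z≤n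

  χ+χ∁ : ∀ A n → χ A n ℕ.+ χ (∁ A) n ≡ 1
  χ+χ∁ A n with dec A n
  ... | yes a = cong₂ ℕ._+_ (χ≡1 A n a) (χ≡0 (∁ A) n λ ¬a → ¬a a)
  ... | no ¬a = cong₂ ℕ._+_ (χ≡0 A n ¬a) (χ≡1 (∁ A) n ¬a)

  count≡cumulative : ∀ A n → count A n ≡ cumulative (χ A) n
  count≡cumulative A zero    = refl
  count≡cumulative A (suc n) = cong (ℕ._+ χ A (suc n)) (count≡cumulative A n)

  count+count∁ : ∀ A n → count A n ℕ.+ count (∁ A) n ≡ n
  count+count∁ A zero    = refl
  count+count∁ A (suc n) = trans
    (interchange ℕ.+-commutativeSemigroup (count A n) (χ A (suc n)) (count (∁ A) n) (χ (∁ A) (suc n)))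
    (trans (cong₂ ℕ._+_ (count+count∁ A n) (χ+χ∁ A (suc n))) (ℕ.+-comm n 1))

  density≈ : ∀ D → mean (count (set D)) ≈ approx (d D)
  density≈ D = ⟶⇒≈ (d D) (hasDensity D)

  0≤ᴿd : ∀ D → fromℚ 0ℚ ≤ᴿ d D
  0≤ᴿd D = eventually (≲-trans (≤⇒≲ λ n → 0≤/ (count (set D) (suc n)) (suc n)) (proj₁ (density≈ D)))

  d≤ᴿ1 : ∀ D → d D ≤ᴿ fromℚ 1ℚ
  d≤ᴿ1 D = eventually (≲-trans (proj₂ (density≈ D)) (≤⇒≲ λ n → ≤-trans
    (/-monoˡ-≤ (suc n) (subst (count (set D) (suc n) ℕ.≤_) (count+count∁ (set D) (suc n)) (ℕ.m≤m+n _ _)))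
    (≤-reflexive (n/n≡1 (suc n)))))

  mean-count∁ : ∀ A n → mean (count (∁ A)) n ≡ (1- mean (count A)) n
  mean-count∁ A n = begin
    y            ≡⟨ solve 2 (λ x y → y := (x :+ y) :- x) refl x y ⟩
    (x + y) - x  ≡⟨ cong (_- x) (/-distribʳ-+ (count A (suc n)) (count (∁ A) (suc n)) (suc n)) ⟨
    pos (count A (suc n) ℕ.+ count (∁ A) (suc n)) / suc n - x
      ≡⟨ cong (λ m → pos m / suc n - x) (count+count∁ A (suc n)) ⟩
    pos (suc n) / suc n - x ≡⟨ cong (_- x) (n/n≡1 (suc n)) ⟩
    1ℚ - x ∎
    where
    open ≡-Reasoning
    x = mean (count A) n
    y = mean (count (∁ A)) n

  ∁𝒟 : 𝒟 → 𝒟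
  ∁𝒟 D = mk𝒟 (∁ (set D)) (1-ᴿ d D) (≈⇒⟶ (1-ᴿ d D)
    (≈-trans (≡⇒≈ (mean-count∁ (set D))) (1≈ (density≈ D))))

  -- Contained in every set, it makes the family defining an inner density inhabited by a member of
  -- value 0.
  ∅𝒟 : 𝒟
  ∅𝒟 = mk𝒟 ∅ (fromℚ 0ℚ) (≈⇒⟶ (fromℚ 0ℚ) (≡⇒≈ λ n →
    trans (cong (λ m → pos m / suc n) (count-∅ (suc n))) (0/n≡0 (suc n))))
    where
    count-∅ : ∀ n → count ∅ n ≡ 0
    count-∅ zero    = refl
    count-∅ (suc n) = cong₂ ℕ._+_ (count-∅ n) (χ≡0 ∅ (suc n) λ ())

  -- Agrees definitionally with `∑χA` and `∑χB`, but takes a bare list and so admits induction.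
  ∑χ : List 𝒟 → ℕ → ℕ
  ∑χ Ds n = sum (map (λ D → χ (set D) n) Ds)

  -- Points are counted with multiplicity, so the densities add even when the sets overlap.
  mean-∑χ : ∀ Ds → mean (cumulative (∑χ Ds)) ≈ approx (sumᴿ (map d Ds))
  mean-∑χ []       = ≡⇒≈ λ n → trans (cong (λ m → pos m / suc n) (cumulative-0 (suc n))) (0/n≡0 (suc n))
  mean-∑χ (D ∷ Ds) = ≈-trans (≡⇒≈ split) (≈-+ (density≈ D) (mean-∑χ Ds))
    where
    split : ∀ n → mean (cumulative (∑χ (D ∷ Ds))) n ≡ mean (count (set D)) n + mean (cumulative (∑χ Ds)) n
    split n = trans
      (cong (λ m → pos m / suc n) (trans (cumulative-+ (χ (set D)) (∑χ Ds) (suc n))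
        (cong (ℕ._+ cumulative (∑χ Ds) (suc n)) (sym (count≡cumulative (set D) (suc n))))))
      (mean-+ (count (set D)) (cumulative (∑χ Ds)) n)

  -- The subset of `A` obtained from a collection.

  module _ (A : Subset) (As Bs : List 𝒟) (K : ℕ) .{{_ : NonZero K}}
    (below : Below A (mkCollections As Bs K)) where

    private
      x = sumᴿ (map d As) -ᴿ sumᴿ (map d Bs)
      M = runningMax (excess (∑χ As) (∑χ Bs))

      -- The points at which ⌊M/K⌋ jumps, so that counting them recovers ⌊M/K⌋.
      B : Subset
      B n = M (ℕ.pred n) ℕ./ K ℕ.< M n ℕ./ K

      M-step : ∀ n → M (suc n) ℕ.≤ M n ℕ.+ K ℕ.* χ A (suc n)
      M-step n = runningMax-step (∑χ As) (∑χ Bs) n (below (suc n) (ℕ.s≤s ℕ.z≤n))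

      -- A multiple of `K` passes through the floor, so growth of `M` by at most K χ_A becomes
      -- growth of ⌊M/K⌋ by at most χ_A.
      M-step≤ : ∀ n → M (suc n) ℕ./ K ℕ.≤ M n ℕ./ K ℕ.+ χ A (suc n)
      M-step≤ n = ℕ.≤-trans (ℕ./-monoˡ-≤ K (M-step n)) (ℕ.≤-reflexive
        (trans (ℕ.+-distrib-/-∣ʳ (M n) (m∣m*n (χ A (suc n))))
          (cong (M n ℕ./ K ℕ.+_) (trans (ℕ./-congˡ (ℕ.*-comm K (χ A (suc n)))) (ℕ.m*n/n≡m (χ A (suc n)) K)))))

      B⊆A : B ⊆⁺ A
      B⊆A (suc n) _ b with dec A (suc n)
      ... | yes a = a
      ... | no ¬a = contradiction b (ℕ.≤⇒≯ (ℕ.≤-trans (M-step≤ n)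
        (ℕ.≤-reflexive (trans (cong (M n ℕ./ K ℕ.+_) (χ≡0 A (suc n) ¬a)) (ℕ.+-identityʳ _)))))

      χ≤1 : ∀ n → χ A n ℕ.≤ 1
      χ≤1 n = ℕ.≤-trans (ℕ.m≤m+n _ _) (ℕ.≤-reflexive (χ+χ∁ A n))

      -- A jump is at least 1 by the choice of `B` and at most 1 by `M-step≤`. Where there is no
      -- jump, monotonicity of `M` forces equality.
      count-B : ∀ n → count B n ≡ M n ℕ./ K
      count-B zero    = sym (ℕ.0/n≡0 K)
      count-B (suc n) with dec B (suc n)
      ... | yes b = trans (cong₂ ℕ._+_ (count-B n) (χ≡1 B (suc n) b)) (ℕ.≤-antisym
        (ℕ.≤-trans (ℕ.≤-reflexive (ℕ.+-comm _ 1)) b)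
        (ℕ.≤-trans (M-step≤ n) (ℕ.+-monoʳ-≤ (M n ℕ./ K) (χ≤1 (suc n)))))
      ... | no ¬b = trans (cong₂ ℕ._+_ (count-B n) (χ≡0 B (suc n) ¬b)) (trans (ℕ.+-identityʳ _) (ℕ.≤-antisym
        (ℕ./-monoˡ-≤ K (ℕ.m≤m⊔n (M n) _)) (ℕ.≮⇒≥ ¬b)))

      density-B : HasDensity B (max0 x /ᴿ K)
      density-B = ≈⇒⟶ (max0 x /ᴿ K) (≈-trans
        (≡⇒≈ λ n → cong (λ m → pos m / suc n) (count-B (suc n)))
        (≈-trans (mean-/ M K) (≈-/ K (mean-runningMax-excess (∑χ As) (∑χ Bs) x
          (≈-+ (mean-∑χ As) (≈-neg (mean-∑χ Bs)))))))

    subset-with-density≥quotient : ∃ λ (D : 𝒟) → set D ⊆⁺ A × quotient (mkCollections As Bs K) ≤ᴿ d D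
    subset-with-density≥quotient = mk𝒟 B (max0 x /ᴿ K) density-B , B⊆A ,
      -- Replacing `x` by max (0, x) before dividing can only raise the value.
      eventually (≲-/ K (≤⇒≲ λ n → p≤q⊔p 0ℚ (approx x n)))

  -- Inner density and `d_*`.

  singleton : 𝒟 → Collections
  singleton D = mkCollections (D ∷ []) [] 1

  -- Through p = 1, q = 0, k = 1, each set competing for an inner or outer density also competes for
  -- `d_*` or `d^*`, with the same value.
  quotient-singleton : ∀ D → approx (quotient (singleton D)) ≈ approx (d D)
  quotient-singleton D = ≡⇒≈ λ n →
    solve 1 (λ p → ((p :+ con 0ℚ) :+ :- con 0ℚ) :* con 1ℚ := p) refl (approx (d D) n)

  inner-density-exists : ∀ A → ∃ λ x → IsInnerDensity A x
  inner-density-exists A = sup-exists em (λ (B , _) → d B) (∅𝒟 , λ _ _ ()) (0≤ᴿd ∅𝒟) (λ (B , _) → d≤ᴿ1 B)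

  -- The two families are cofinal in each other: every quotient is below the density of some subset,
  -- and every such density is the quotient of a singleton.
  inner⇒lower : ∀ A x → IsInnerDensity A x → IsLower-d⁎ A x
  inner⇒lower A x (bound , least) =
      (λ (c@(mkCollections As Bs k) , below) →
        let B , B⊆A , q≤d = subset-with-density≥quotient A As Bs k below in
        ≤ᴿ-trans (quotient c) (d B) x q≤d (bound (B , B⊆A)))
    , λ y q≤y → least y λ (B , B⊆A) → ≤ᴿ-trans (d B) (quotient (singleton B)) y
        (eventually (proj₂ (quotient-singleton B)))
        (q≤y (singleton B , λ n 1≤n → ℕ.+-monoˡ-≤ 0
          (ℕ.≤-trans (χ-mono (set B) A n (B⊆A n 1≤n)) (ℕ.≤-reflexive (sym (ℕ.*-identityˡ _))))))

  -- Outer density and `d^*`, by complementation.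

  -- Complements exchange supersets of `A` with subsets of `∁ A` and turn a density into 1 minus it,
  -- so the supremum becomes an infimum.
  inner∁⇒outer : ∀ A x → IsInnerDensity (∁ A) x → IsOuterDensity A (1-ᴿ x)
  inner∁⇒outer A x (bound , least) =
      (λ (C , A⊆C) → 1-ᴿ-swapˡ (d C) x (bound (∁𝒟 C , λ n 1≤n ¬c a → ¬c (A⊆C n 1≤n a))))
    , λ y y≤d → 1-ᴿ-swapʳ x y (least (1-ᴿ y) λ (B , B⊆∁A) →
        1-ᴿ-swapʳ y (d B) (y≤d (∁𝒟 B , λ n 1≤n a b → B⊆∁A n 1≤n b a)))

  ℕ𝒟 : 𝒟
  ℕ𝒟 = ∁𝒟 ∅𝒟

  -- Subtracting the inequality of an upper collection from k = k χ_A + k χ_∁A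
  -- turns it into a lower collection for the complement.
  dual : Collections → Collections
  dual (mkCollections As Bs k) = mkCollections (replicate k ℕ𝒟 ++ Bs) As k

  ∑χ-replicate-++ : ∀ k Ds n → ∑χ (replicate k ℕ𝒟 ++ Ds) n ≡ k ℕ.+ ∑χ Ds n
  ∑χ-replicate-++ zero    Ds n = refl
  ∑χ-replicate-++ (suc k) Ds n = cong₂ ℕ._+_ (χ≡1 (set ℕ𝒟) n λ ()) (∑χ-replicate-++ k Ds n)

  sumᴿ-ℕ𝒟-++ : ∀ k Ds n →
    approx (sumᴿ (map d (replicate k ℕ𝒟 ++ Ds))) n ≡ ι k + approx (sumᴿ (map d Ds)) n
  sumᴿ-ℕ𝒟-++ k Ds n = trans
    (cong (λ xs → approx (sumᴿ xs) n)
      (trans (map-++ d (replicate k ℕ𝒟) Ds) (cong (_++ map d Ds) (map-replicate d k ℕ𝒟))))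
    (sumᴿ-replicate-++ k (d ℕ𝒟) (map d Ds) n refl)

  -- The `k` copies of ℕ contribute k/k = 1, and exchanging the two lists negates the rest.
  quotient-dual : ∀ c n → approx (quotient (dual c)) n ≡ approx (1-ᴿ quotient c) n
  quotient-dual (mkCollections As Bs k) n = begin
    (approx (sumᴿ (map d (replicate k ℕ𝒟 ++ Bs))) n - a) * j
      ≡⟨ cong (λ s → (s - a) * j) (sumᴿ-ℕ𝒟-++ k Bs n) ⟩
    ((ι k + b) - a) * j
      ≡⟨ solve 4 (λ k a b j → ((k :+ b) :- a) :* j := k :* j :- (a :- b) :* j) refl (ι k) a b j ⟩
    ι k * j - (a - b) * j ≡⟨ cong (_- (a - b) * j) (ι*1/n≡1 k) ⟩
    1ℚ - (a - b) * j ∎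
    where
    open ≡-Reasoning
    a = approx (sumᴿ (map d As)) n
    b = approx (sumᴿ (map d Bs)) n
    j = pos 1 / k

  dual-below : ∀ A c → Above A c → Below (∁ A) (dual c)
  dual-below A c@(mkCollections As Bs k) above n 1≤n = begin
    ∑χ (replicate k ℕ𝒟 ++ Bs) n                     ≡⟨ ∑χ-replicate-++ k Bs n ⟩
    k ℕ.+ ∑χ Bs n                                   ≡⟨ cong (ℕ._+ ∑χ Bs n) k*1≡k ⟨
    k ℕ.* (χ (∁ A) n ℕ.+ χ A n) ℕ.+ ∑χ Bs n         ≡⟨ cong (ℕ._+ ∑χ Bs n) (ℕ.*-distribˡ-+ k (χ (∁ A) n) (χ A n)) ⟩
    k ℕ.* χ (∁ A) n ℕ.+ k ℕ.* χ A n ℕ.+ ∑χ Bs n     ≡⟨ ℕ.+-assoc (k ℕ.* χ (∁ A) n) _ _ ⟩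
    k ℕ.* χ (∁ A) n ℕ.+ (k ℕ.* χ A n ℕ.+ ∑χ Bs n)   ≤⟨ ℕ.+-monoʳ-≤ (k ℕ.* χ (∁ A) n) (above n 1≤n) ⟩
    k ℕ.* χ (∁ A) n ℕ.+ ∑χ As n                     ∎
    where
    open ℕ.≤-Reasoning
    k*1≡k : k ℕ.* (χ (∁ A) n ℕ.+ χ A n) ≡ k
    k*1≡k = trans (cong (k ℕ.*_) (trans (ℕ.+-comm (χ (∁ A) n) (χ A n)) (χ+χ∁ A n))) (ℕ.*-identityʳ k)

  -- The dual of an upper collection has quotient at most `x`, which bounds the original quotient
  -- below by 1 - x. That no lower bound is larger follows from the outer density, via singletons.
  inner∁⇒upper : ∀ A x → IsInnerDensity (∁ A) x → IsUpper-d* A (1-ᴿ x)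
  inner∁⇒upper A x inner =
      (λ (c , above) → 1-ᴿ-swapˡ (quotient c) x
        (≤ᴿ-trans (1-ᴿ quotient c) (quotient (dual c)) x
          (eventually (≡⇒≲ λ n → sym (quotient-dual c n)))
          (proj₁ (inner⇒lower (∁ A) x inner) (dual c , dual-below A c above))))
    , λ y y≤q → proj₂ (inner∁⇒outer A x inner) y λ (C , A⊆C) →
        ≤ᴿ-trans y (quotient (singleton C)) (d C)
          (y≤q (singleton C , λ n 1≤n → ℕ.+-monoˡ-≤ 0
            (ℕ.≤-trans (ℕ.≤-reflexive (ℕ.*-identityˡ _)) (χ-mono A (set C) n (A⊆C n 1≤n)))))
          (eventually (proj₁ (quotient-singleton C)))

theorem3p2 : (em : ExcludedMiddle (Level.suc 0ℓ)) (A : Subset) →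
    let open Density em in
    (∃ λ x → IsInnerDensity A x × IsLower-d⁎ A x) ×
    (∃ λ y → IsOuterDensity A y × IsUpper-d* A y)
theorem3p2 em A =
  -- Only two suprema are constructed, for `A` and for its complement; the other properties are
  -- transferred from these.
  let x , inner  = inner-density-exists em A
      y , inner∁ = inner-density-exists em (∁ A)
  in (x , inner , inner⇒lower em A x inner)
   , (1-ᴿ y , inner∁⇒outer em A y inner∁ , inner∁⇒upper em A y inner∁)
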